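{- Let $r\ge 8$ and $m\ge 2$ be integers, and put $$G_{m,r}=C_m^{\,r-5}\oplus C_{2m}^{\,4}\oplus C_{6m}.$$ Then $G_{m,r}$ has rank $r$, and there is a zero-sum-free sequence over $G_{m,r}$ of length $(r+10)m-r$ whose terms generate $G_{m,r}$. Moreover $\mathsf d^*(G_{m,r})=(r+9)m-r$, and hence $$\mathsf d(G_{m,r})-\mathsf d^*(G_{m,r})\ge m.$$
   Context: All groups are finite, abelian and written additively; $C_n$ denotes the cyclic group of order $n$. The rank of a group is its minimum number of generators. A sequence over a group $G$ is a finite unordered multiset of elements of $G$ (repetitions allowed); its length is the number of terms counted with multiplicity, and a subsequence is a sub-multiset. A sequence is zero-sum free if it has no nonempty subsequence whose terms sum to $0$. The small Davenport constant $\mathsf d(G)$ is the maximum length of a zero-sum-free sequence over $G$. If $G\cong C_{n_1}\oplus\cdots\oplus C_{n_s}$ with $1<n_1\mid\cdots\mid n_s$ (invariant-factor decomposition), then $\mathsf d^*(G)=\sum_{i=1}^s(n_i-1)$. -}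

module Defs where

open import Level using (0ℓ)
open import Algebra.Bundles using (AbelianGroup)
open import Algebra.Morphism.Structures using (IsGroupIsomorphism)
import Algebra.Construct.DirectProduct as DirectProduct
import Algebra.Construct.Terminal as Terminal
open import Data.Integer as ℤ using (ℤ; +_)
import Data.Integer.Properties as ℤ
open import Data.Integer.Divisibility.Signed using (divides; ∣m∣n⇒∣m+n; ∣m⇒∣-m) renaming (_∣_ to _∣ℤ_)
open import Data.Integer.Tactic.RingSolver using (solve-∀)
open import Data.List using (List; []; foldr; length; map; sum)
open import Data.List.Membership.Propositional using (_∈_)
open import Data.List.Relation.Binary.Sublist.Propositional using (_⊆_)
open import Data.List.Relation.Unary.All using (All)
open import Data.List.Relation.Unary.Linked using (Linked)
open import Data.Nat using (ℕ; zero; suc; _*_; _∸_; _<_; _≤_)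
open import Data.Nat.Divisibility using (_∣_)
open import Data.Product using (_×_; _,_; ∃-syntax)
open import Relation.Binary.PropositionalEquality using (_≡_; _≢_; refl; subst)
open import Relation.Nullary using (¬_)

AbGroup : Set₁
AbGroup = AbelianGroup 0ℓ 0ℓ

-- A record, rather than an abbreviation for the divisibility, so that x and y
-- can be inferred from a proof of congruence.
record _≡_[mod_] (x y : ℤ) (n : ℕ) : Set where
  constructor mod≡
  field
    n∣x-y : + n ∣ℤ x ℤ.- y

open _≡_[mod_] public

module _ {n : ℕ} where

  mod-reflexive : ∀ {x y} → x ≡ y → x ≡ y [mod n ]
  mod-reflexive {x} refl = mod≡ (divides (+ 0) (eq x (+ n)))
    where
    eq : ∀ a k → a ℤ.- a ≡ + 0 ℤ.* k
    eq = solve-∀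

  mod-sym : ∀ {x y} → x ≡ y [mod n ] → y ≡ x [mod n ]
  mod-sym {x} {y} (mod≡ p) = mod≡ (subst (+ n ∣ℤ_) (eq x y) (∣m⇒∣-m p))
    where
    eq : ∀ a b → ℤ.- (a ℤ.- b) ≡ b ℤ.- a
    eq = solve-∀

  mod-trans : ∀ {x y z} → x ≡ y [mod n ] → y ≡ z [mod n ] → x ≡ z [mod n ]
  mod-trans {x} {y} {z} (mod≡ p) (mod≡ q) =
    mod≡ (subst (+ n ∣ℤ_) (eq x y z) (∣m∣n⇒∣m+n p q))
    where
    eq : ∀ a b c → (a ℤ.- b) ℤ.+ (b ℤ.- c) ≡ a ℤ.- c
    eq = solve-∀

  mod-+ : ∀ {x y u v} → x ≡ y [mod n ] → u ≡ v [mod n ] → (x ℤ.+ u) ≡ (y ℤ.+ v) [mod n ]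
  mod-+ {x} {y} {u} {v} (mod≡ p) (mod≡ q) =
    mod≡ (subst (+ n ∣ℤ_) (eq x y u v) (∣m∣n⇒∣m+n p q))
    where
    eq : ∀ a b c d → (a ℤ.- b) ℤ.+ (c ℤ.- d) ≡ (a ℤ.+ c) ℤ.- (b ℤ.+ d)
    eq = solve-∀

  mod-neg : ∀ {x y} → x ≡ y [mod n ] → (ℤ.- x) ≡ (ℤ.- y) [mod n ]
  mod-neg {x} {y} (mod≡ p) = mod≡ (subst (+ n ∣ℤ_) (eq x y) (∣m⇒∣-m p))
    where
    eq : ∀ a b → ℤ.- (a ℤ.- b) ≡ (ℤ.- a) ℤ.- (ℤ.- b)
    eq = solve-∀

-- ℤ/nℤ: integers under addition, with congruence modulo n as the setoid
-- equality.  It is the cyclic group of order n for n ≥ 1 (for n = 0 it is ℤ).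
C : ℕ → AbGroup
C n = record
  { Carrier        = ℤ
  ; _≈_            = λ x y → x ≡ y [mod n ]
  ; _∙_            = ℤ._+_
  ; ε              = + 0
  ; _⁻¹            = ℤ.-_
  ; isAbelianGroup = record
    { isGroup = record
      { isMonoid = record
        { isSemigroup = record
          { isMagma = record
            { isEquivalence = record
              { refl  = mod-reflexive refl
              ; sym   = mod-sym
              ; trans = mod-trans
              }
            ; ∙-cong = mod-+
            }
          ; assoc = λ x y z → mod-reflexive (ℤ.+-assoc x y z)
          }
        ; identity = (λ x → mod-reflexive (ℤ.+-identityˡ x))
                   , (λ x → mod-reflexive (ℤ.+-identityʳ x))
        }
      ; inverse = (λ x → mod-reflexive (ℤ.+-inverseˡ x))
                , (λ x → mod-reflexive (ℤ.+-inverseʳ x))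
      ; ⁻¹-cong = mod-neg
      }
    ; comm = λ x y → mod-reflexive (ℤ.+-comm x y)
    }
  }

infixr 6 _⊕_
infix  8 _^⊕_
infix  4 _≅_

_⊕_ : AbGroup → AbGroup → AbGroup
_⊕_ = DirectProduct.abelianGroup

𝟘 : AbGroup
𝟘 = Terminal.abelianGroup

_^⊕_ : AbGroup → ℕ → AbGroup
G ^⊕ zero  = 𝟘
G ^⊕ suc k = G ⊕ G ^⊕ k

⨁C : List ℕ → AbGroup
⨁C ns = foldr _⊕_ 𝟘 (map C ns)

_≅_ : AbGroup → AbGroup → Set
G ≅ H = ∃[ f ] IsGroupIsomorphism (AbelianGroup.rawGroup G) (AbelianGroup.rawGroup H) f

-- Sequences over G are lists of elements.  The order of the terms is
-- irrelevant to every notion below, and the subsequences (sub-multisets) of S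
-- are, up to order, its sublists T ⊆ S.
module _ (G : AbGroup) where
  open AbelianGroup G

  σ : List Carrier → Carrier
  σ = foldr _∙_ ε

  ZeroSumFree : List Carrier → Set
  ZeroSumFree S = ∀ T → T ⊆ S → T ≢ [] → ¬ (σ T ≈ ε)

  -- The subgroup generated by the terms of S, as a predicate on G.
  data ⟨_⟩ (S : List Carrier) : Carrier → Set where
    gen  : ∀ {x} → x ∈ S → ⟨ S ⟩ x
    unit : ⟨ S ⟩ ε
    mul  : ∀ {x y} → ⟨ S ⟩ x → ⟨ S ⟩ y → ⟨ S ⟩ (x ∙ y)
    inv  : ∀ {x} → ⟨ S ⟩ x → ⟨ S ⟩ (x ⁻¹)
    resp : ∀ {x y} → x ≈ y → ⟨ S ⟩ x → ⟨ S ⟩ y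

  Generates : List Carrier → Set
  Generates S = ∀ x → ⟨ S ⟩ x

  -- IsRank k, IsSmallDavenport k and IsDStar k say that the rank, 𝖽(G) and
  -- 𝖽*(G) respectively exist and are equal to k.
  IsRank : ℕ → Set
  IsRank k = (∃[ S ] (length S ≡ k × Generates S))
           × (∀ S → Generates S → k ≤ length S)

  IsSmallDavenport : ℕ → Set
  IsSmallDavenport k = (∃[ S ] (length S ≡ k × ZeroSumFree S))
                     × (∀ S → ZeroSumFree S → length S ≤ k)

  -- Linked _∣_ ns is the divisibility chain n₁ ∣ n₂ ∣ ⋯ ∣ nₛ.  By uniqueness
  -- of invariant factors, at most one list ns satisfies the first three
  -- conditions.
  IsDStar : ℕ → Set
  IsDStar k = ∃[ ns ] (All (1 <_) ns × Linked _∣_ ns × G ≅ ⨁C ns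
                       × sum (map (_∸ 1) ns) ≡ k)

G[_,_] : ℕ → ℕ → AbGroup
G[ m , r ] = C m ^⊕ (r ∸ 5) ⊕ C (2 * m) ^⊕ 4 ⊕ C (6 * m)

{-# OPTIONS --safe #-}

-- Let m = suc n.  In G[ m , 8 ], with coordinates (u₁ u₂ u₃ ∣ v₁ v₂ v₃ v₄ ∣ w), take the terms
--   q₁ = (1 0 0 ∣ 1 0 1 1 ∣ 2),   q₂ = (0 1 0 ∣ 1 1 0 1 ∣ 2),   q₃ = (0 0 1 ∣ 1 1 1 0 ∣ 2),
--   b  = (0 0 0 ∣ 1 0 0 0 ∣ 1),   p₁, p₂, p₃ = (0 0 0 ∣ 0 1 0 0 ∣ 2), …, (0 0 0 ∣ 0 0 0 1 ∣ 2)
-- 2m − 1 times each, and a = (0 0 0 ∣ 0 0 0 0 ∣ 1) 4m − 1 times.  The integer matrix of these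
-- eight vectors is unitriangular, so they generate, and the multiplicities in a zero-sum
-- subsequence are all divisible by m.  Dividing by m leaves a zero-sum subsequence of the
-- sequence with m = 1, which lives in C₂⁴ ⊕ C₆, has length 10 and is zero-sum free.  Each
-- further summand C m contributes m − 1 copies of its generator.
--
-- The rank is bounded below by counting: k elements generate at most mᵏ elements of the
-- quotient C m ^⊕ r.  The Davenport constant exists because zero-sum freeness is decidable and
-- bounds the length by the order of the group.

module Submission where

open import Defs
open import Algebra.Bundles using (AbelianGroup)
import Algebra.Morphism.Construct.Composition as Composition
import Algebra.Morphism.Construct.Identity as Identity
open import Algebra.Morphism.Structures using (IsGroupHomomorphism; IsGroupIsomorphism)
import Algebra.Properties.CommutativeMonoid.Mult as Mult
import Algebra.Properties.CommutativeSemigroup as CommutativeSemigroupProperties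
import Algebra.Properties.Group as GroupProperties
open import Data.Fin using (Fin; zero; suc; toℕ; fromℕ<; combine; remQuot)
import Data.Fin.Properties as Fin
open import Data.Integer as ℤ using (ℤ; +_; -[1+_])
import Data.Integer.DivMod as ℤ
import Data.Integer.Properties as ℤ
open import Data.Integer.Divisibility.Signed using (divides; ∣⇒∣ᵤ; ∣ᵤ⇒∣) renaming (_∣_ to _∣ℤ_; ∣-trans to ∣ℤ-trans)
import Data.Integer.Tactic.RingSolver as ℤ-Solver
open import Data.List using (List; []; _∷_; _++_; length; map; replicate; take; drop)
import Data.List.Properties as List
open import Data.List.Membership.Propositional using (_∈_)
open import Data.List.Membership.Propositional.Properties using (∈-map⁺; ∈-++⁺ˡ; ∈-++⁺ʳ)
open import Data.List.Relation.Binary.Pointwise as Pointwise using (Pointwise; []; _∷_)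
open import Data.List.Relation.Binary.Sublist.Propositional using (_⊆_; []; _∷_; _∷ʳ_; ⊆-trans)
open import Data.List.Relation.Binary.Sublist.Propositional.Properties using (take-⊆; drop-⊆)
import Data.List.Relation.Binary.Subset.Propositional.Properties as Subset
open import Data.List.Relation.Unary.All using (All; []; _∷_)
import Data.List.Relation.Unary.All.Properties as All
open import Data.List.Relation.Unary.Any using (here; there)
open import Data.List.Relation.Unary.Linked using (Linked; [-]; _∷_)
open import Data.Nat
  using (ℕ; zero; suc; _+_; _*_; _∸_; _^_; _%_; _/_; _≤_; _<_; _≥_; z≤n; s≤s; NonZero; >-nonZero; >-nonZero⁻¹)
import Data.Nat.DivMod as ℕ
open import Data.Nat.Divisibility using (_∣_; divides-refl; ∣-refl)
import Data.Nat.Divisibility as ℕ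
open import Data.Nat.ListAction using (sum)
import Data.Nat.Properties as ℕ
import Data.Nat.Tactic.RingSolver as ℕ-Solver
open import Data.Product using (_×_; _,_; proj₁; proj₂; ∃-syntax)
open import Data.Sum using (inj₁; inj₂)
open import Data.Unit.Polymorphic using (tt)
open import Data.Vec as Vec using (Vec; []; _∷_)
import Data.Vec.Properties as Vec
import Data.Vec.Relation.Binary.Pointwise.Inductive as VecPointwise
open VecPointwise using ([]; _∷_)
import Data.Vec.Relation.Unary.All as VecAll
open VecAll using ([]; _∷_)
open import Function using (_∘_; id)
open import Relation.Binary.Definitions using (Decidable)
open import Relation.Binary.PropositionalEquality using (_≡_; _≢_; refl; cong; cong₂; subst; subst₂)
import Relation.Binary.PropositionalEquality as ≡
open import Relation.Nullary using (¬_; Dec; yes; no; contradiction)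
open import Relation.Nullary.Decidable using (map′; _×-dec_; _→-dec_; ¬?; toWitness)

-- Homomorphisms, direct sums and generated subgroups

∣_∣ᴳ : AbGroup → Set
∣ G ∣ᴳ = AbelianGroup.Carrier G

IsHom : (G H : AbGroup) → (∣ G ∣ᴳ → ∣ H ∣ᴳ) → Set
IsHom G H = IsGroupHomomorphism (AbelianGroup.rawGroup G) (AbelianGroup.rawGroup H)

module _ (G H : AbGroup) where
  private
    module G = AbelianGroup G
    module H = AbelianGroup H

  -- Preservation of the identity and of inverses follows from additivity by cancellation in `H`.
  isHom : (f : ∣ G ∣ᴳ → ∣ H ∣ᴳ) → (∀ {x y} → x G.≈ y → f x H.≈ f y) →
          (∀ x y → f (x G.∙ y) H.≈ f x H.∙ f y) → IsHom G H f
  isHom f f-cong homo = record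
    { isMonoidHomomorphism = record
      { isMagmaHomomorphism = record
        { isRelHomomorphism = record { cong = f-cong }
        ; homo = homo
        }
      ; ε-homo = ε-homo
      }
    ; ⁻¹-homo = λ x → inverseˡ-unique (f (x G.⁻¹)) (f x)
        (H.trans (H.sym (homo (x G.⁻¹) x)) (H.trans (f-cong (G.inverseˡ x)) ε-homo))
    }
    where
    open GroupProperties H.group using (inverseˡ-unique; identityˡ-unique)
    ε-homo : f G.ε H.≈ H.ε
    ε-homo = identityˡ-unique (f G.ε) (f G.ε)
               (H.trans (H.sym (homo G.ε G.ε)) (f-cong (G.identityˡ G.ε)))

  ≅-intro : (f : ∣ G ∣ᴳ → ∣ H ∣ᴳ) → IsHom G H f →
            (∀ {x y} → f x H.≈ f y → x G.≈ y) → (∀ y → ∃[ x ] f x H.≈ y) → G ≅ H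
  ≅-intro f hom inj surj = f , record
    { isGroupMonomorphism = record { isGroupHomomorphism = hom ; injective = inj }
    ; surjective = λ y → proj₁ (surj y) , λ eq → H.trans (IsGroupHomomorphism.⟦⟧-cong hom eq) (proj₂ (surj y))
    }

  module _ {f : ∣ G ∣ᴳ → ∣ H ∣ᴳ} (hom : IsHom G H f) where
    open IsGroupHomomorphism hom

    σ-map : ∀ S → σ H (map f S) H.≈ f (σ G S)
    σ-map [] = H.sym ε-homo
    σ-map (x ∷ S) = H.trans (H.∙-congˡ (σ-map S)) (H.sym (homo x (σ G S)))

    ⟨⟩-map : ∀ {S x} → ⟨_⟩ G S x → ⟨_⟩ H (map f S) (f x)
    ⟨⟩-map (gen x∈S) = gen (∈-map⁺ f x∈S)
    ⟨⟩-map unit = resp (H.sym ε-homo) unit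
    ⟨⟩-map (mul p q) = resp (H.sym (homo _ _)) (mul (⟨⟩-map p) (⟨⟩-map q))
    ⟨⟩-map (inv p) = resp (H.sym (⁻¹-homo _)) (inv (⟨⟩-map p))
    ⟨⟩-map (resp eq p) = resp (⟦⟧-cong eq) (⟨⟩-map p)

    generates-map : (∀ y → ∃[ x ] f x H.≈ y) → ∀ {S} → Generates G S → Generates H (map f S)
    generates-map surj gens y = resp (proj₂ (surj y)) (⟨⟩-map (gens (proj₁ (surj y))))

module _ (G H : AbGroup) where
  private
    module G = AbelianGroup G
    module H = AbelianGroup H

  inˡ : ∣ G ∣ᴳ → ∣ G ⊕ H ∣ᴳ
  inˡ x = x , H.ε

  inʳ : ∣ H ∣ᴳ → ∣ G ⊕ H ∣ᴳ
  inʳ y = G.ε , y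

  inˡ-hom : IsHom G (G ⊕ H) inˡ
  inˡ-hom = isHom G (G ⊕ H) inˡ (_, H.refl) (λ x y → G.refl , H.sym (H.identityˡ H.ε))

  inʳ-hom : IsHom H (G ⊕ H) inʳ
  inʳ-hom = isHom H (G ⊕ H) inʳ (G.refl ,_) (λ x y → G.sym (G.identityˡ G.ε) , H.refl)

module _ (G : AbGroup) where
  open AbelianGroup G renaming (refl to ≈-refl; sym to ≈-sym; trans to ≈-trans)

  σ-++ : ∀ S T → σ G (S ++ T) ≈ σ G S ∙ σ G T
  σ-++ [] T = ≈-sym (identityˡ _)
  σ-++ (x ∷ S) T = ≈-trans (∙-congˡ (σ-++ S T)) (≈-sym (assoc x _ _))

  ⟨⟩-mono : ∀ {S T} → (∀ {x} → x ∈ S → x ∈ T) → ∀ {x} → ⟨_⟩ G S x → ⟨_⟩ G T x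
  ⟨⟩-mono S⊆T (gen x∈S) = gen (S⊆T x∈S)
  ⟨⟩-mono S⊆T unit = unit
  ⟨⟩-mono S⊆T (mul p q) = mul (⟨⟩-mono S⊆T p) (⟨⟩-mono S⊆T q)
  ⟨⟩-mono S⊆T (inv p) = inv (⟨⟩-mono S⊆T p)
  ⟨⟩-mono S⊆T (resp eq p) = resp eq (⟨⟩-mono S⊆T p)

  zeroSumFree⇒≡[] : ∀ {S T} → ZeroSumFree G S → T ⊆ S → σ G T ≈ ε → T ≡ []
  zeroSumFree⇒≡[] {T = []} free T⊆S σ≈ε = refl
  zeroSumFree⇒≡[] {T = x ∷ T} free T⊆S σ≈ε = contradiction σ≈ε (free (x ∷ T) T⊆S λ ())

-- Sublists of concatenated, constant and mapped lists

module _ {A : Set} where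

  ⊆-++⁻ : ∀ (xs : List A) {ys T} → T ⊆ xs ++ ys →
          ∃[ T₁ ] ∃[ T₂ ] (T ≡ T₁ ++ T₂ × T₁ ⊆ xs × T₂ ⊆ ys)
  ⊆-++⁻ [] T⊆ = [] , _ , refl , [] , T⊆
  ⊆-++⁻ (x ∷ xs) (.x ∷ʳ T⊆) with T₁ , T₂ , eq , p , q ← ⊆-++⁻ xs T⊆ = T₁ , T₂ , eq , x ∷ʳ p , q
  ⊆-++⁻ (x ∷ xs) (refl ∷ T⊆) with T₁ , T₂ , eq , p , q ← ⊆-++⁻ xs T⊆ =
    x ∷ T₁ , T₂ , cong (x ∷_) eq , refl ∷ p , q

  ⊆-replicate⁻ : ∀ v {x : A} {T} → T ⊆ replicate v x → ∃[ n ] (n ≤ v × T ≡ replicate n x)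
  ⊆-replicate⁻ zero [] = 0 , z≤n , refl
  ⊆-replicate⁻ (suc v) (_ ∷ʳ T⊆) with n , n≤v , eq ← ⊆-replicate⁻ v T⊆ = n , ℕ.m≤n⇒m≤1+n n≤v , eq
  ⊆-replicate⁻ (suc v) (refl ∷ T⊆) with n , n≤v , eq ← ⊆-replicate⁻ v T⊆ = suc n , s≤s n≤v , cong (_ ∷_) eq

⊆-map⁻ : ∀ {A B : Set} (f : A → B) S {T} → T ⊆ map f S → ∃[ T′ ] (T ≡ map f T′ × T′ ⊆ S)
⊆-map⁻ f [] [] = [] , refl , []
⊆-map⁻ f (x ∷ S) (_ ∷ʳ T⊆) with T′ , eq , p ← ⊆-map⁻ f S T⊆ = T′ , eq , x ∷ʳ p
⊆-map⁻ f (x ∷ S) (refl ∷ T⊆) with T′ , eq , p ← ⊆-map⁻ f S T⊆ = x ∷ T′ , cong (f x ∷_) eq , refl ∷ p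

-- Zero-sum-free generating sequences under isomorphisms and direct sums

-- The generating list B witnesses the upper bound on the rank.
record FreeGenerating (G : AbGroup) (ℓ k : ℕ) : Set where
  field
    S B         : List ∣ G ∣ᴳ
    length-S    : length S ≡ ℓ
    length-B    : length B ≡ k
    zeroSumFree : ZeroSumFree G S
    B⊆S         : ∀ {x} → x ∈ B → x ∈ S
    generates   : Generates G B

open FreeGenerating

module _ {G H : AbGroup} where
  private
    module G = AbelianGroup G
    module H = AbelianGroup H

  FreeGenerating-≅ : ∀ {ℓ k} → G ≅ H → FreeGenerating G ℓ k → FreeGenerating H ℓ k
  FreeGenerating-≅ (f , iso) F = record
    { S = map f (S F)
    ; B = map f (B F)
    ; length-S = ≡.trans (List.length-map f (S F)) (length-S F)
    ; length-B = ≡.trans (List.length-map f (B F)) (length-B F)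
    ; zeroSumFree = free
    ; B⊆S = Subset.map⁺ f (B⊆S F)
    ; generates = generates-map G H isGroupHomomorphism
        (λ y → proj₁ (surjective y) , proj₂ (surjective y) G.refl) (generates F)
    }
    where
    open IsGroupIsomorphism iso
    free : ZeroSumFree H (map f (S F))
    free T T⊆ T≢[] σ≈ε with T′ , refl , T′⊆ ← ⊆-map⁻ f (S F) T⊆ =
      T≢[] (cong (map f) (zeroSumFree⇒≡[] G (zeroSumFree F) T′⊆
        (injective (H.trans (H.sym (σ-map G H isGroupHomomorphism T′)) (H.trans σ≈ε (H.sym ε-homo))))))

  -- A subsequence of the joined sequence splits into one part per summand, and its sum is the pair
  -- of the two partial sums. If it vanishes, both parts are empty.
  FreeGenerating-⊕ : ∀ {ℓ₁ ℓ₂ k₁ k₂} → FreeGenerating G ℓ₁ k₁ → FreeGenerating H ℓ₂ k₂ →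
                     FreeGenerating (G ⊕ H) (ℓ₁ + ℓ₂) (k₁ + k₂)
  FreeGenerating-⊕ {ℓ₁} {ℓ₂} {k₁} {k₂} F E = record
    { S = join (S F) (S E)
    ; B = join (B F) (B E)
    ; length-S = ≡.trans (length-join (S F) (S E)) (cong₂ _+_ (length-S F) (length-S E))
    ; length-B = ≡.trans (length-join (B F) (B E)) (cong₂ _+_ (length-B F) (length-B E))
    ; zeroSumFree = free
    ; B⊆S = Subset.++⁺ (Subset.map⁺ inl (B⊆S F)) (Subset.map⁺ inr (B⊆S E))
    ; generates = λ (x , y) → resp (G.identityʳ x , H.identityˡ y)
        (mul (⟨⟩-mono (G ⊕ H) ∈-++⁺ˡ (⟨⟩-map G (G ⊕ H) (inˡ-hom G H) (generates F x)))
             (⟨⟩-mono (G ⊕ H) (∈-++⁺ʳ _) (⟨⟩-map H (G ⊕ H) (inʳ-hom G H) (generates E y))))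
    }
    where
    module K = AbelianGroup (G ⊕ H)
    inl = inˡ G H
    inr = inʳ G H
    join : List ∣ G ∣ᴳ → List ∣ H ∣ᴳ → List ∣ G ⊕ H ∣ᴳ
    join S T = map inl S ++ map inr T

    length-join : ∀ S T → length (join S T) ≡ length S + length T
    length-join S T = ≡.trans (List.length-++ (map inl S))
                              (cong₂ _+_ (List.length-map inl S) (List.length-map inr T))

    σ-join : ∀ S T → σ (G ⊕ H) (join S T) K.≈ (σ G S , σ H T)
    σ-join S T = K.trans (σ-++ (G ⊕ H) (map inl S) (map inr T))
      (K.trans (K.∙-cong (σ-map G (G ⊕ H) (inˡ-hom G H) S) (σ-map H (G ⊕ H) (inʳ-hom G H) T))
               (G.identityʳ _ , H.identityˡ _))

    free : ZeroSumFree (G ⊕ H) (join (S F) (S E))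
    free T T⊆ T≢[] σ≈ε
      with T₁ , T₂ , refl , p , q ← ⊆-++⁻ (map inl (S F)) T⊆
      with T₁′ , refl , p′ ← ⊆-map⁻ inl (S F) p
         | T₂′ , refl , q′ ← ⊆-map⁻ inr (S E) q
      with e₁ , e₂ ← K.trans (K.sym (σ-join T₁′ T₂′)) σ≈ε =
      T≢[] (cong₂ join (zeroSumFree⇒≡[] G (zeroSumFree F) p′ e₁) (zeroSumFree⇒≡[] H (zeroSumFree E) q′ e₂))

-- Enumerations of finite groups

module _ (G : AbGroup) where
  open AbelianGroup G renaming (refl to ≈-refl; sym to ≈-sym; trans to ≈-trans)

  -- A bijection between `Fin n` and the classes of `_≈_`, so `n` is the order of the group. That
  -- `index` respects `_≈_` follows from `val-index` and `val-injective`.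
  record Enumeration (n : ℕ) : Set where
    field
      val           : Fin n → Carrier
      index         : Carrier → Fin n
      val-index     : ∀ x → val (index x) ≈ x
      val-injective : ∀ {i j} → val i ≈ val j → i ≡ j

    infix 4 _≈?_
    _≈?_ : Decidable _≈_
    x ≈? y = map′
      (λ eq → ≈-trans (≈-sym (val-index x)) (≈-trans (reflexive (cong val eq)) (val-index y)))
      (λ eq → val-injective (≈-trans (val-index x) (≈-trans eq (≈-sym (val-index y)))))
      (index x Fin.≟ index y)

open Enumeration

Enumeration-C : ∀ n .{{_ : NonZero n}} → Enumeration (C n) n
Enumeration-C n = record
  { val = λ i → + toℕ i
  ; index = λ x → fromℕ< (ℤ.n%ℕd<d x n)
  ; val-index = λ x → mod≡ (divides (ℤ.- (x ℤ./ℕ n)) (lemma x))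
  ; val-injective = λ {i} {j} p → Fin.toℕ-injective (inj (Fin.toℕ<n i) (Fin.toℕ<n j) (n∣x-y p) )
  }
  where
  identity : ∀ a q k → a ℤ.- (a ℤ.+ q ℤ.* k) ≡ (ℤ.- q) ℤ.* k
  identity = ℤ-Solver.solve-∀
  lemma : ∀ x → + toℕ (fromℕ< (ℤ.n%ℕd<d x n)) ℤ.- x ≡ ℤ.- (x ℤ./ℕ n) ℤ.* + n
  lemma x = ≡.trans (cong₂ (λ a b → + a ℤ.- b) (Fin.toℕ-fromℕ< (ℤ.n%ℕd<d x n)) (ℤ.a≡a%ℕn+[a/ℕn]*n x n))
                    (identity (+ (x ℤ.%ℕ n)) (x ℤ./ℕ n) (+ n))
  -- The difference `a ∸ b` is a multiple of `n` and at most `a < n`, hence zero.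
  half : ∀ {a b} → a < n → b ≤ a → + n ∣ℤ + a ℤ.- + b → a ≡ b
  half {a} {b} a<n b≤a d
    with a ∸ b in eq | ℕ.m∸n≤m a b
       | subst (n ∣_) (cong ℤ.∣_∣ (≡.trans (ℤ.[+m]-[+n]≡m⊖n a b) (ℤ.⊖-≥ b≤a))) (∣⇒∣ᵤ d)
  ... | zero | _ | _ = ℕ.≤-antisym (ℕ.m∸n≡0⇒m≤n eq) b≤a
  ... | suc c | le | n∣ = contradiction (ℕ.≤-trans (ℕ.∣⇒≤ n∣) le) (ℕ.<⇒≱ a<n)
  inj : ∀ {a b} → a < n → b < n → + n ∣ℤ + a ℤ.- + b → a ≡ b
  inj {a} {b} a<n b<n d with ℕ.≤-total b a
  ... | inj₁ b≤a = half a<n b≤a d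
  ... | inj₂ a≤b = ≡.sym (half b<n a≤b (n∣x-y (mod-sym (mod≡ {x = + a} {+ b} {n} d))))

Enumeration-⊕ : ∀ {G H k n} → Enumeration G k → Enumeration H n → Enumeration (G ⊕ H) (k * n)
Enumeration-⊕ {G} {H} {k} {n} E F = record
  { val = λ i → val E (proj₁ (remQuot {k} n i)) , val F (proj₂ (remQuot {k} n i))
  ; index = λ (x , y) → combine (index E x) (index F y)
  ; val-index = λ (x , y) → K.trans
      (K.reflexive (cong (λ (i , j) → val E i , val F j) (Fin.remQuot-combine (index E x) (index F y))))
      (val-index E x , val-index F y)
  ; val-injective = λ {i} {j} (p , q) → ≡.trans (≡.sym (Fin.combine-remQuot {k} n i))
      (≡.trans (cong₂ combine (val-injective E p) (val-injective F q)) (Fin.combine-remQuot {k} n j))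
  }
  where module K = AbelianGroup (G ⊕ H)

Enumeration-𝟘 : Enumeration 𝟘 1
Enumeration-𝟘 = record
  { val = λ _ → tt
  ; index = λ _ → zero
  ; val-index = λ _ → tt
  ; val-injective = λ { {zero} {zero} _ → refl }
  }

Enumeration-^⊕ : ∀ {G n} k → Enumeration G n → Enumeration (G ^⊕ k) (n ^ k)
Enumeration-^⊕ zero E = Enumeration-𝟘
Enumeration-^⊕ (suc k) E = Enumeration-⊕ E (Enumeration-^⊕ k E)

-- Existence of the small Davenport constant

all-⊆? : ∀ {A : Set} {Q : List A → Set} → (∀ T → Dec (Q T)) → ∀ S → Dec (∀ T → T ⊆ S → Q T)
all-⊆? Q? [] = map′ (λ { q .[] [] → q }) (λ f → f [] []) (Q? [])
all-⊆? Q? (x ∷ S) = map′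
  (λ { (f , g) T (.x ∷ʳ p) → f T p ; (f , g) (.x ∷ T) (refl ∷ p) → g T p })
  (λ f → (λ T p → f T (x ∷ʳ p)) , (λ T p → f (x ∷ T) (refl ∷ p)))
  (all-⊆? Q? S ×-dec all-⊆? (Q? ∘ (x ∷_)) S)

-- Search downwards from the bound `N`; `P 0` guarantees that the search succeeds.
bounded-maximum : ∀ {P : ℕ → Set} → (∀ k → Dec (P k)) → P 0 → ∀ N → (∀ k → P k → k ≤ N) →
                  ∃[ d ] (P d × (∀ k → P k → k ≤ d))
bounded-maximum P? p₀ zero bound = 0 , p₀ , bound
bounded-maximum P? p₀ (suc N) bound with P? (suc N)
... | yes p = suc N , p , bound
... | no ¬p = bounded-maximum P? p₀ N λ k pk → ℕ.≤-pred (ℕ.≤∧≢⇒< (bound k pk) λ { refl → ¬p pk })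

module _ {G : AbGroup} {n : ℕ} (E : Enumeration G n) where
  open AbelianGroup G renaming (refl to ≈-refl; sym to ≈-sym; trans to ≈-trans)
  open GroupProperties group using (identityˡ-unique)

  -- The carrier may be infinite, so only the representatives `val E i` are tried. This suffices
  -- because `P` respects termwise equality.
  any-list? : ∀ {P : List Carrier → Set} → (∀ {S T} → Pointwise _≈_ S T → P S → P T) → (∀ S → Dec (P S)) →
              ∀ k → Dec (∃[ S ] (length S ≡ k × P S))
  any-list? P-resp P? zero = map′ (λ p → [] , refl , p) (λ { ([] , _ , p) → p }) (P? [])
  any-list? P-resp P? (suc k) = map′
    (λ (i , S , eq , p) → val E i ∷ S , cong suc eq , p)
    (λ { (x ∷ S , refl , p) → index E x , S , refl ,
         P-resp (≈-sym (val-index E x) ∷ Pointwise.refl ≈-refl) p })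
    (Fin.any? λ i → any-list? (λ eqs → P-resp (≈-refl ∷ eqs)) (P? ∘ (val E i ∷_)) k)

  σ-cong : ∀ {S T} → Pointwise _≈_ S T → σ G S ≈ σ G T
  σ-cong [] = ≈-refl
  σ-cong (eq ∷ eqs) = ∙-cong eq (σ-cong eqs)

  ⊆-Pointwise : ∀ {S S′ T} → Pointwise _≈_ S S′ → T ⊆ S′ → ∃[ T′ ] (T′ ⊆ S × Pointwise _≈_ T′ T)
  ⊆-Pointwise [] [] = [] , [] , []
  ⊆-Pointwise (eq ∷ eqs) (_ ∷ʳ p) with T′ , q , eqs′ ← ⊆-Pointwise eqs p = T′ , _ ∷ʳ q , eqs′
  ⊆-Pointwise (eq ∷ eqs) (refl ∷ p) with T′ , q , eqs′ ← ⊆-Pointwise eqs p = _ , refl ∷ q , eq ∷ eqs′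

  zeroSumFree-resp : ∀ {S S′} → Pointwise _≈_ S S′ → ZeroSumFree G S → ZeroSumFree G S′
  zeroSumFree-resp eqs free T T⊆ T≢[] σ≈ε with T′ , p , eqs′ ← ⊆-Pointwise eqs T⊆ =
    free T′ p (λ { refl → T≢[] (Pointwise-[] eqs′) }) (≈-trans (σ-cong eqs′) σ≈ε)
    where
    Pointwise-[] : ∀ {T} → Pointwise _≈_ [] T → T ≡ []
    Pointwise-[] [] = refl

  zeroSumFree? : ∀ S → Dec (ZeroSumFree G S)
  zeroSumFree? = all-⊆? λ where
    [] → yes λ []≢[] → contradiction refl []≢[]
    (x ∷ T) → map′ (λ ¬z _ → ¬z) (λ f → f λ ()) (¬? (_≈?_ E (σ G (x ∷ T)) ε))

  -- Used to cancel: if the suffixes starting at `i` and at `i + k` have equal sums, the segment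
  -- between them sums to zero.
  drop-drop-σ : ∀ S i k → σ G (drop i S) ≈ σ G (take k (drop i S)) ∙ σ G (drop (i + k) S)
  drop-drop-σ S i k = ≈-trans
    (reflexive (cong (σ G) (≡.sym
      (≡.trans (cong (take k (drop i S) ++_) (drop-+ i S)) (List.take++drop≡id k (drop i S))))))
    (σ-++ G (take k (drop i S)) _)
    where
    drop-+ : ∀ i S → drop (i + k) S ≡ drop k (drop i S)
    drop-+ zero S = refl
    drop-+ (suc i) [] = ≡.sym (List.drop-[] k)
    drop-+ (suc i) (x ∷ S) = drop-+ i S

  -- Among more than n suffixes of S two have the same sum, and the segment between their
  -- starting points sums to zero.
  zeroSumFree-length : ∀ {S} → ZeroSumFree G S → length S ≤ n
  zeroSumFree-length {S} free with length S ℕ.≤? n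
  ... | yes p = p
  ... | no ¬p
    with i , j , i<j , eq ← Fin.pigeonhole (ℕ.m<n⇒m<1+n (ℕ.≰⇒> ¬p)) (λ i → index E (σ G (drop (toℕ i) S))) =
    contradiction
      (identityˡ-unique _ _ (≈-trans (≈-sym (drop-drop-σ S (toℕ i) k)) same))
      (free _ (⊆-trans (take-⊆ k (drop (toℕ i) S)) (drop-⊆ (toℕ i) S)) (nonempty (drop (toℕ i) S) i<len 0<k))
    where
    k = toℕ j ∸ toℕ i
    i+k≡j : toℕ i + k ≡ toℕ j
    i+k≡j = ℕ.m+[n∸m]≡n (ℕ.<⇒≤ i<j)
    0<k : 0 < k
    0<k = ℕ.m<n⇒0<n∸m i<j
    i<len : 0 < length (drop (toℕ i) S)
    i<len = subst (0 <_) (≡.sym (List.length-drop (toℕ i) S))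
              (ℕ.m<n⇒0<n∸m (ℕ.<-≤-trans i<j (ℕ.≤-pred (Fin.toℕ<n j))))
    nonempty : ∀ {k} (xs : List Carrier) → 0 < length xs → 0 < k → take k xs ≢ []
    nonempty {suc k} (x ∷ xs) _ _ ()
    same : σ G (drop (toℕ i) S) ≈ σ G (drop (toℕ i + k) S)
    same = ≈-trans (≈-sym (val-index E _)) (≈-trans (reflexive (cong (val E) eq))
             (≈-trans (val-index E _) (reflexive (cong (λ l → σ G (drop l S)) (≡.sym i+k≡j)))))

  smallDavenport : ∃[ d ] IsSmallDavenport G d
  smallDavenport with d , max , bound ← bounded-maximum
         (any-list? zeroSumFree-resp zeroSumFree?)
         ([] , refl , λ { _ [] T≢[] _ → T≢[] refl })
         n (λ { _ (S , refl , free) → zeroSumFree-length free }) =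
    d , max , λ S free → bound (length S) (S , refl , free)

-- Counting the elements generated in a group of exponent dividing `m`

module _ {G : AbGroup} where
  open AbelianGroup G renaming (refl to ≈-refl; sym to ≈-sym; trans to ≈-trans)
  open Mult commutativeMonoid renaming (_×_ to _·_)
  open CommutativeSemigroupProperties commutativeSemigroup using (interchange)
  open GroupProperties group using (inverseˡ-unique)

  module _ {m : ℕ} {{_ : NonZero m}} (m·≈ε : ∀ x → m · x ≈ ε) where

    *m·≈ε : ∀ c x → (c * m) · x ≈ ε
    *m·≈ε zero x = ≈-refl
    *m·≈ε (suc c) x = ≈-trans (×-homo-+ x m (c * m)) (≈-trans (∙-cong (m·≈ε x) (*m·≈ε c x)) (identityˡ ε))

    %·≈ : ∀ c x → (c % m) · x ≈ c · x
    %·≈ c x = ≈-trans (≈-sym (identityʳ _)) (≈-trans (∙-congˡ (≈-sym (*m·≈ε (c / m) x)))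
      (≈-trans (≈-sym (×-homo-+ x (c % m) (c / m * m))) (×-congˡ (≡.sym (ℕ.m≡m%n+[m/n]*n c m)))))

    -- Induction on the derivation collects the occurrences of `s` into one natural-number
    -- coefficient.
    ⟨∷⟩⁻ : ∀ {s S x} → ⟨_⟩ G (s ∷ S) x → ∃[ c ] ∃[ y ] (⟨_⟩ G S y × c · s ∙ y ≈ x)
    ⟨∷⟩⁻ (gen (here refl)) = 1 , ε , unit , ≈-trans (identityʳ _) (×-homo-1 _)
    ⟨∷⟩⁻ (gen (there x∈)) = 0 , _ , gen x∈ , identityˡ _
    ⟨∷⟩⁻ unit = 0 , ε , unit , identityˡ ε
    ⟨∷⟩⁻ {s} (mul p q)
      with c , y , y∈ , eq ← ⟨∷⟩⁻ p | d , z , z∈ , eq′ ← ⟨∷⟩⁻ q =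
      c + d , y ∙ z , mul y∈ z∈ ,
      ≈-trans (∙-congʳ (×-homo-+ s c d)) (≈-trans (interchange _ _ _ _) (∙-cong eq eq′))
    -- Since `m` annihilates the group, `c * (m ∸ 1)` copies of `s` are the inverse of `c` copies,
    -- and the coefficient stays natural.
    ⟨∷⟩⁻ {s} (inv p) with c , y , y∈ , eq ← ⟨∷⟩⁻ p =
      c * (m ∸ 1) , y ⁻¹ , inv y∈ , inverseˡ-unique _ _
        (≈-trans (∙-congˡ (≈-sym eq)) (≈-trans (interchange _ _ _ _)
          (≈-trans (∙-cong cancel (inverseˡ y)) (identityˡ ε))))
      where
      [c*[m∸1]]+c≡c*m : c * (m ∸ 1) + c ≡ c * m
      [c*[m∸1]]+c≡c*m = ≡.trans (ℕ.+-comm (c * (m ∸ 1)) c) (≡.trans (≡.sym (ℕ.*-suc c (m ∸ 1)))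
        (cong (c *_) (ℕ.suc-pred m)))
      cancel : (c * (m ∸ 1)) · s ∙ c · s ≈ ε
      cancel = ≈-trans (≈-sym (×-homo-+ s (c * (m ∸ 1)) c)) (≈-trans (×-congˡ [c*[m∸1]]+c≡c*m) (*m·≈ε c s))
    ⟨∷⟩⁻ (resp eq p) with c , y , y∈ , eq′ ← ⟨∷⟩⁻ p = c , y , y∈ , ≈-trans eq′ eq

    -- The index is read as `length S` digits in base `m`, which serve as the coefficients of the
    -- terms of `S`.
    combination : ∀ S → Fin (m ^ length S) → Carrier
    combination [] _ = ε
    combination (s ∷ S) i =
      toℕ (proj₁ (remQuot {m} (m ^ length S) i)) · s ∙ combination S (proj₂ (remQuot {m} (m ^ length S) i))

    ⟨[]⟩⁻ : ∀ {x} → ⟨_⟩ G [] x → ε ≈ x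
    ⟨[]⟩⁻ unit = ≈-refl
    ⟨[]⟩⁻ (mul p q) = ≈-trans (≈-sym (identityˡ ε)) (∙-cong (⟨[]⟩⁻ p) (⟨[]⟩⁻ q))
    ⟨[]⟩⁻ (inv p) = ≈-trans (≈-sym (GroupProperties.ε⁻¹≈ε group)) (⁻¹-cong (⟨[]⟩⁻ p))
    ⟨[]⟩⁻ (resp eq p) = ≈-trans (⟨[]⟩⁻ p) eq

    combination-surjective : ∀ S {x} → ⟨_⟩ G S x → ∃[ i ] combination S i ≈ x
    combination-surjective [] p = zero , ⟨[]⟩⁻ p
    combination-surjective (s ∷ S) {x} p
      with c , y , y∈ , eq ← ⟨∷⟩⁻ p
      with j , eq′ ← combination-surjective S y∈ = combine i j ,
        ≈-trans (reflexive (cong (λ (i , j) → toℕ i · s ∙ combination S j) (Fin.remQuot-combine i j)))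
          (≈-trans (∙-cong (≈-trans (×-congˡ (Fin.toℕ-fromℕ< (ℕ.m%n<n c m))) (%·≈ c s)) eq′) eq)
      where i = fromℕ< (ℕ.m%n<n c m)

    -- Choosing a digit string for each of the `n` elements gives an injection, since the string
    -- determines the element.
    generates⇒≤ : ∀ {n S} → Enumeration G n → Generates G S → n ≤ m ^ length S
    generates⇒≤ {S = S} E gens = Fin.injective⇒≤ {f = f} λ {i} {j} eq →
      val-injective E (≈-trans (≈-sym (proj₂ (code i))) (≈-trans (reflexive (cong (combination S) eq)) (proj₂ (code j))))
      where
      code = λ i → combination-surjective S (gens (val E i))
      f = proj₁ ∘ code

-- Lower bound on the rank by reduction modulo `m`

module _ (m : ℕ) where

  private
    module _ (G : AbGroup) where
      open Mult (AbelianGroup.commutativeMonoid G) public using () renaming (_×_ to _·_)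

  Annihilates : AbGroup → Set
  Annihilates G = ∀ x → AbelianGroup._≈_ G (_·_ G m x) (AbelianGroup.ε G)

  ·-⊕ : ∀ G H n x y → _·_ (G ⊕ H) n (x , y) ≡ (_·_ G n x , _·_ H n y)
  ·-⊕ G H zero x y = refl
  ·-⊕ G H (suc n) x y = cong (AbelianGroup._∙_ (G ⊕ H) (x , y)) (·-⊕ G H n x y)

  annihilates-⊕ : ∀ {G H} → Annihilates G → Annihilates H → Annihilates (G ⊕ H)
  annihilates-⊕ {G} {H} p q (x , y) =
    AbelianGroup.trans (G ⊕ H) (AbelianGroup.reflexive (G ⊕ H) (·-⊕ G H m x y)) (p x , q y)

  annihilates-C : Annihilates (C m)
  annihilates-C x = mod≡ (divides x (≡.trans (ℤ.+-identityʳ _) (≡.trans (·-* m) (ℤ.*-comm (+ m) x))))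
    where
    ·-* : ∀ n → _·_ (C m) n x ≡ + n ℤ.* x
    ·-* zero = ≡.sym (ℤ.*-zeroˡ x)
    ·-* (suc n) = ≡.trans (cong (λ z → x ℤ.+ z) (·-* n)) (≡.sym (ℤ.suc-* (+ n) x))

  annihilates-C^⊕ : ∀ k → Annihilates (C m ^⊕ k)
  annihilates-C^⊕ zero x = tt
  annihilates-C^⊕ (suc k) = annihilates-⊕ {C m} {C m ^⊕ k} annihilates-C (annihilates-C^⊕ k)

  -- On integer representatives this is the identity; only the moduli change, from the entries of
  -- `ns` to `m`. It respects equality when `m` divides all of them.
  reduce : ∀ ns → ∣ ⨁C ns ∣ᴳ → ∣ C m ^⊕ length ns ∣ᴳ
  reduce [] x = tt
  reduce (n ∷ ns) (x , y) = x , reduce ns y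

  mod-∣ : ∀ {n x y} → m ∣ n → x ≡ y [mod n ] → x ≡ y [mod m ]
  mod-∣ m∣n (mod≡ n∣) = mod≡ (∣ℤ-trans (∣ᵤ⇒∣ m∣n) n∣)

  reduce-hom : ∀ {ns} → All (m ∣_) ns → IsHom (⨁C ns) (C m ^⊕ length ns) (reduce ns)
  reduce-hom {ns} m∣ns = isHom (⨁C ns) (C m ^⊕ length ns) (reduce ns) (r-cong m∣ns) (r-homo ns)
    where
    r-cong : ∀ {ns} → All (m ∣_) ns → ∀ {x y} → AbelianGroup._≈_ (⨁C ns) x y →
             AbelianGroup._≈_ (C m ^⊕ length ns) (reduce ns x) (reduce ns y)
    r-cong [] _ = tt
    r-cong (m∣n ∷ m∣ns) (p , q) = mod-∣ m∣n p , r-cong m∣ns q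
    r-homo : ∀ ns x y → let open AbelianGroup (C m ^⊕ length ns) in
             reduce ns (AbelianGroup._∙_ (⨁C ns) x y) ≈ reduce ns x ∙ reduce ns y
    r-homo [] _ _ = tt
    r-homo (n ∷ ns) (x , y) (z , w) = mod-reflexive refl , r-homo ns y w

  reduce-surjective : ∀ ns y → ∃[ x ] AbelianGroup._≈_ (C m ^⊕ length ns) (reduce ns x) y
  reduce-surjective [] y = tt , tt
  reduce-surjective (n ∷ ns) (x , y) with z , eq ← reduce-surjective ns y = (x , z) , mod-reflexive refl , eq

  -- The image of `S` generates `C m ^⊕ length ns`, so `m ^ length ns ≤ m ^ length S`. As `m ≥ 2`,
  -- powers of `m` are strictly increasing in the exponent.
  rank-≥ : ∀ {G ns} → m ≥ 2 → All (m ∣_) ns → G ≅ ⨁C ns → ∀ S → Generates G S → length ns ≤ length S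
  rank-≥ {G} {ns} m≥2 m∣ns (f , iso) S gens with length ns ℕ.≤? length S
  ... | yes p = p
  ... | no ¬p = contradiction
    (subst (λ l → m ^ length ns ≤ m ^ l) (≡.trans (List.length-map _ (map f S)) (List.length-map f S))
      (generates⇒≤ (annihilates-C^⊕ (length ns)) (Enumeration-^⊕ (length ns) (Enumeration-C m)) gens′))
    (ℕ.<⇒≱ (ℕ.^-monoʳ-< m m≥2 (ℕ.≰⇒> ¬p)))
    where
    instance
      _ : NonZero m
      _ = >-nonZero (ℕ.<⇒≤ m≥2)
    open IsGroupIsomorphism iso
    gens′ : Generates (C m ^⊕ length ns) (map (reduce ns) (map f S))
    gens′ = generates-map (⨁C ns) (C m ^⊕ length ns) (reduce-hom m∣ns) (reduce-surjective ns)
      (generates-map G (⨁C ns) isGroupHomomorphism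
        (λ y → proj₁ (surjective y) , proj₂ (surjective y) (AbelianGroup.refl G)) gens)

-- Sequences given by multiplicities, and their coordinate sums

module _ {A : Set} where

  -- Equal terms stand together, so every sublist has the same form with multiplicities that are no
  -- larger.
  blocks : ∀ {k} → Vec A k → Vec ℕ k → List A
  blocks [] [] = []
  blocks (x ∷ xs) (n ∷ ns) = replicate n x ++ blocks xs ns

  length-blocks : ∀ {k} (xs : Vec A k) ns → length (blocks xs ns) ≡ Vec.sum ns
  length-blocks [] [] = refl
  length-blocks (x ∷ xs) (n ∷ ns) = ≡.trans (List.length-++ (replicate n x))
    (cong₂ _+_ (List.length-replicate n) (length-blocks xs ns))

  ∈-blocks : ∀ {k} {xs : Vec A k} {ns} → VecAll.All (1 ≤_) ns → ∀ {x} → x ∈ Vec.toList xs → x ∈ blocks xs ns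
  ∈-blocks {xs = x ∷ xs} {suc n ∷ ns} (p ∷ ps) (here eq) = here eq
  ∈-blocks {xs = x ∷ xs} {n ∷ ns} (p ∷ ps) (there x∈) = ∈-++⁺ʳ (replicate n x) (∈-blocks ps x∈)

  ⊆-blocks⁻ : ∀ {k} (xs : Vec A k) vs {T} → T ⊆ blocks xs vs →
              ∃[ ns ] (VecPointwise.Pointwise _≤_ ns vs × T ≡ blocks xs ns)
  ⊆-blocks⁻ [] [] [] = [] , [] , refl
  ⊆-blocks⁻ (x ∷ xs) (v ∷ vs) T⊆
    with T₁ , T₂ , refl , p , q ← ⊆-++⁻ (replicate v x) T⊆
    with n , n≤v , refl ← ⊆-replicate⁻ v p
    with ns , ns≤vs , refl ← ⊆-blocks⁻ xs vs q = n ∷ ns , n≤v ∷ ns≤vs , refl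

dot : ∀ {k} → Vec ℕ k → Vec ℕ k → ℕ
dot [] [] = 0
dot (c ∷ cs) (n ∷ ns) = n * c + dot cs ns

dot-* : ∀ {k} m (cs ns : Vec ℕ k) → dot cs (Vec.map (_* m) ns) ≡ dot cs ns * m
dot-* m [] [] = refl
dot-* m (c ∷ cs) (n ∷ ns) = ≡.trans (cong (λ z → n * m * c + z) (dot-* m cs ns)) (identity m c n (dot cs ns))
  where
  identity : ∀ m c n d → n * m * c + d * m ≡ (n * c + d) * m
  identity = ℕ-Solver.solve-∀

module _ (G : AbGroup) (π : ∣ G ∣ᴳ → ℤ) (π-ε : π (AbelianGroup.ε G) ≡ + 0)
         (π-∙ : ∀ x y → π (AbelianGroup._∙_ G x y) ≡ π x ℤ.+ π y) where

  -- The coordinate `π` is additive with exact integer values, so it can be summed in ℤ; congruences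
  -- enter only in `∣-dot`.
  coordinate-σ : ∀ {k} (xs : Vec ∣ G ∣ᴳ k) cs ns → Vec.map π xs ≡ Vec.map +_ cs → π (σ G (blocks xs ns)) ≡ + dot cs ns
  coordinate-σ [] [] [] _ = π-ε
  coordinate-σ (x ∷ xs) (c ∷ cs) (zero ∷ ns) eq = coordinate-σ xs cs ns (Vec.∷-injectiveʳ eq)
  coordinate-σ (x ∷ xs) (c ∷ cs) (suc n ∷ ns) eq = ≡.trans (π-∙ x _)
    (≡.trans (cong₂ ℤ._+_ (Vec.∷-injectiveˡ eq) (coordinate-σ (x ∷ xs) (c ∷ cs) (n ∷ ns) eq))
      (cong +_ (≡.sym (ℕ.+-assoc c (n * c) (dot cs ns)))))

  ∣-dot : ∀ {k d} (xs : Vec ∣ G ∣ᴳ k) cs ns → Vec.map π xs ≡ Vec.map +_ cs →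
          π (σ G (blocks xs ns)) ≡ + 0 [mod d ] → d ∣ dot cs ns
  ∣-dot {d = d} xs cs ns eq (mod≡ p) = ∣⇒∣ᵤ (subst (+ d ∣ℤ_) (≡.trans (ℤ.+-identityʳ _) (coordinate-σ xs cs ns eq)) p)

-- The unitriangular matrix and the finite check for `m = 1`

all-box? : ∀ {k} {P : Vec ℕ k → Set} → (∀ ns → Dec (P ns)) → ∀ (vs : Vec ℕ k) →
           Dec (∀ ns → VecPointwise.Pointwise _≤_ ns vs → P ns)
all-box? P? [] = map′ (λ { p [] [] → p }) (λ f → f [] []) (P? [])
all-box? P? (v ∷ vs) = map′
  (λ { f (n ∷ ns) (n≤v ∷ ns≤vs) → f (s≤s n≤v) ns ns≤vs })
  (λ { f n<1+v ns ns≤vs → f (_ ∷ ns) (ℕ.≤-pred n<1+v ∷ ns≤vs) })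
  -- `allUpTo?` ranges strictly below its argument, hence `suc v`.
  (ℕ.allUpTo? (λ n → all-box? (P? ∘ (n ∷_)) vs) (suc v))

-- One step of forward substitution: earlier multiplicities contribute multiples of `d`, later ones
-- have coefficient 0, and `n` itself has coefficient 1.
pivot : ∀ {d j k n} (cs₁ : Vec ℕ j) {ns₁} (ns₂ : Vec ℕ k) → VecAll.All (d ∣_) ns₁ →
        d ∣ dot (cs₁ Vec.++ 1 ∷ Vec.replicate k 0) (ns₁ Vec.++ n ∷ ns₂) → d ∣ n
pivot {d} {n = n} [] {[]} ns₂ [] d∣ =
  subst (d ∣_) (≡.trans (cong₂ _+_ (ℕ.*-identityʳ n) (dot-zeros ns₂)) (ℕ.+-identityʳ n)) d∣
  where
  dot-zeros : ∀ {k} (ns : Vec ℕ k) → dot (Vec.replicate k 0) ns ≡ 0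
  dot-zeros [] = refl
  dot-zeros (n ∷ ns) = cong₂ _+_ (ℕ.*-zeroʳ n) (dot-zeros ns)
pivot (c ∷ cs₁) ns₂ (p ∷ ps) d∣ = pivot cs₁ ns₂ ps (ℕ.∣m+n∣m⇒∣n d∣ (ℕ.∣m⇒∣m*n c p))

-- Each row lists one coordinate of the eight terms in the order q₁, q₂, q₃, b, p₁, p₂, p₃, a. The
-- entries of `capacities` are the multiplicities 2m - 1 and 4m - 1 at m = 1.
row-u₁ row-u₂ row-u₃ row-v₁ row-v₂ row-v₃ row-v₄ row-w capacities : Vec ℕ 8
row-u₁ = 1 ∷ 0 ∷ 0 ∷ 0 ∷ 0 ∷ 0 ∷ 0 ∷ 0 ∷ []
row-u₂ = 0 ∷ 1 ∷ 0 ∷ 0 ∷ 0 ∷ 0 ∷ 0 ∷ 0 ∷ []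
row-u₃ = 0 ∷ 0 ∷ 1 ∷ 0 ∷ 0 ∷ 0 ∷ 0 ∷ 0 ∷ []
row-v₁ = 1 ∷ 1 ∷ 1 ∷ 1 ∷ 0 ∷ 0 ∷ 0 ∷ 0 ∷ []
row-v₂ = 0 ∷ 1 ∷ 1 ∷ 0 ∷ 1 ∷ 0 ∷ 0 ∷ 0 ∷ []
row-v₃ = 1 ∷ 0 ∷ 1 ∷ 0 ∷ 0 ∷ 1 ∷ 0 ∷ 0 ∷ []
row-v₄ = 1 ∷ 1 ∷ 0 ∷ 0 ∷ 0 ∷ 0 ∷ 1 ∷ 0 ∷ []
row-w  = 2 ∷ 2 ∷ 2 ∷ 1 ∷ 2 ∷ 2 ∷ 2 ∷ 1 ∷ []
capacities = 1 ∷ 1 ∷ 1 ∷ 1 ∷ 1 ∷ 1 ∷ 1 ∷ 3 ∷ []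

-- Decided by evaluation on the 512 vectors of the box. By hand: if t of the terms q₁, q₂, q₃ occur,
-- the v-rows make b occur exactly when t is odd and make 0, 2, 2 or 0 of the pᵢ occur for t = 0, 1,
-- 2, 3. With α ≤ 3 copies of a, the w-row is α, 7 + α, 8 + α or 7 + α, divisible by 6 only when t =
-- α = 0.
box-zeroSumFree : ∀ ns → VecPointwise.Pointwise _≤_ ns capacities →
  2 ∣ dot row-v₁ ns → 2 ∣ dot row-v₂ ns → 2 ∣ dot row-v₃ ns → 2 ∣ dot row-v₄ ns →
  6 ∣ dot row-w ns → ns ≡ Vec.replicate 8 0
box-zeroSumFree = toWitness {a? = all-box? (λ ns →
  2 ℕ.∣? dot row-v₁ ns →-dec 2 ℕ.∣? dot row-v₂ ns →-dec 2 ℕ.∣? dot row-v₃ ns →-dec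
  2 ℕ.∣? dot row-v₄ ns →-dec 6 ℕ.∣? dot row-w ns →-dec
  Vec.≡-dec ℕ._≟_ ns (Vec.replicate 8 0)) capacities} _

-- Generation, one cyclic summand at a time

hom-∘ : ∀ H K G {f g} → IsHom K G g → IsHom H K f → IsHom H G (g ∘ f)
hom-∘ H K G g f = Composition.isGroupHomomorphism (AbelianGroup.trans G) f g

unitVector : ∀ n k → Fin k → ∣ C n ^⊕ k ∣ᴳ
unitVector n (suc k) zero = inˡ (C n) (C n ^⊕ k) (+ 1)
unitVector n (suc k) (suc i) = inʳ (C n) (C n ^⊕ k) (unitVector n k i)

module _ {G : AbGroup} {S : List ∣ G ∣ᴳ} where
  open AbelianGroup G renaming (refl to ≈-refl; sym to ≈-sym; trans to ≈-trans)

  -- The map `f` is kept general so that the recursion over summands can replace it by its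
  -- composites with `inˡ` and `inʳ`.
  Covers : ∀ H → (∣ H ∣ᴳ → Carrier) → Set
  Covers H f = ∀ x → ⟨_⟩ G S (f x)

  covers-C : ∀ n {f} → IsHom (C n) G f → ⟨_⟩ G S (f (+ 1)) → Covers (C n) f
  covers-C n {f} hom f1∈ = λ { (+ k) → pos k ; (-[1+ k ]) → resp (≈-sym (⁻¹-homo (+ suc k))) (inv (pos (suc k))) }
    where
    open IsGroupHomomorphism hom
    pos : ∀ k → ⟨_⟩ G S (f (+ k))
    pos zero = resp (≈-sym ε-homo) unit
    pos (suc k) = resp (≈-sym (homo (+ 1) (+ k))) (mul f1∈ (pos k))

  covers-⊕ : ∀ H K {f} → IsHom (H ⊕ K) G f → Covers H (f ∘ inˡ H K) → Covers K (f ∘ inʳ H K) →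
             Covers (H ⊕ K) f
  covers-⊕ H K {f} hom p q (x , y) =
    resp (≈-trans (≈-sym (homo _ _)) (⟦⟧-cong (AbelianGroup.identityʳ H x , AbelianGroup.identityˡ K y)))
         (mul (p x) (q y))
    where open IsGroupHomomorphism hom

  covers-C^⊕ : ∀ n k {f} → IsHom (C n ^⊕ k) G f → (∀ i → ⟨_⟩ G S (f (unitVector n k i))) → Covers (C n ^⊕ k) f
  covers-C^⊕ n zero hom _ x = resp (≈-sym (IsGroupHomomorphism.ε-homo hom)) unit
  covers-C^⊕ n (suc k) hom units = covers-⊕ (C n) (C n ^⊕ k) hom
    (covers-C n (hom-∘ (C n) (C n ^⊕ suc k) G hom (inˡ-hom (C n) (C n ^⊕ k))) (units zero))
    (covers-C^⊕ n k (hom-∘ (C n ^⊕ k) (C n ^⊕ suc k) G hom (inʳ-hom (C n) (C n ^⊕ k))) (units ∘ suc))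

-- The extra summands `C m`

-- The sequence has `n` copies of 1, one fewer than the order, so no nonempty part of it has a sum
-- divisible by `suc n`. As `n` is nonzero, the generator does occur.
FreeGenerating-C : ∀ n .{{_ : NonZero n}} → FreeGenerating (C (suc n)) n 1
FreeGenerating-C n@(suc _) = record
  { S = blocks (+ 1 ∷ []) (n ∷ [])
  ; B = + 1 ∷ []
  ; length-S = ≡.trans (length-blocks (+ 1 ∷ []) (n ∷ [])) (ℕ.+-identityʳ n)
  ; length-B = refl
  ; zeroSumFree = free
  ; B⊆S = λ { (here eq) → here eq }
  ; generates = covers-C (suc n) (Identity.isGroupHomomorphism _ (AbelianGroup.refl (C (suc n)))) (gen (here refl))
  }
  where
  free : ZeroSumFree (C (suc n)) (blocks (+ 1 ∷ []) (n ∷ []))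
  free T T⊆ T≢[] σ≈0 with ⊆-blocks⁻ (+ 1 ∷ []) (n ∷ []) T⊆
  ... | zero ∷ [] , _ , refl = T≢[] refl
  ... | k@(suc _) ∷ [] , k≤n ∷ [] , refl = ℕ.<⇒≱ (s≤s k≤n) (ℕ.∣⇒≤
    (subst (suc n ∣_) (≡.trans (ℕ.+-identityʳ (k * 1)) (ℕ.*-identityʳ k))
      (∣-dot (C (suc n)) id refl (λ _ _ → refl) (+ 1 ∷ []) (1 ∷ []) (k ∷ []) refl σ≈0)))

FreeGenerating-C^⊕ : ∀ n .{{_ : NonZero n}} k → FreeGenerating (C (suc n) ^⊕ k) (k * n) k
FreeGenerating-C^⊕ n zero = record
  { S = [] ; B = [] ; length-S = refl ; length-B = refl
  ; zeroSumFree = λ { _ [] T≢[] _ → T≢[] refl }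
  ; B⊆S = id
  ; generates = λ _ → unit
  }
FreeGenerating-C^⊕ n (suc k) =
  FreeGenerating-⊕ {C (suc n)} {C (suc n) ^⊕ k} (FreeGenerating-C n) (FreeGenerating-C^⊕ n k)

-- The group of rank 8

-- With m = `suc n`, the bound `n + v * suc n` equals (v + 1)m - 1, and a multiple qm stays within
-- it exactly when q ≤ v.
divide-box : ∀ n {k} {ns vs : Vec ℕ k} → VecAll.All (suc n ∣_) ns →
             VecPointwise.Pointwise _≤_ ns (Vec.map (λ v → n + v * suc n) vs) →
             ∃[ ks ] (ns ≡ Vec.map (_* suc n) ks × VecPointwise.Pointwise _≤_ ks vs)
divide-box n {vs = []} [] [] = [] , refl , []
divide-box n {vs = v ∷ vs} (divides-refl q ∷ ps) (q*m≤ ∷ les) with ks , eq , bs ← divide-box n ps les =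
  q ∷ ks , cong (q * suc n ∷_) eq , ℕ.≤-pred (ℕ.*-cancelʳ-< (suc n) q (suc v) (s≤s q*m≤)) ∷ bs

module _ (n : ℕ) .{{_ : NonZero n}} where
  G₈ : AbGroup
  G₈ = G[ suc n , 8 ]

  private
    m : ℕ
    m = suc n

    open AbelianGroup G₈ using (_∙_; _⁻¹; _≈_; ε)

    element : (u₁ u₂ u₃ v₁ v₂ v₃ v₄ w : ℕ) → ∣ G₈ ∣ᴳ
    element u₁ u₂ u₃ v₁ v₂ v₃ v₄ w =
      (+ u₁ , + u₂ , + u₃ , tt) , (+ v₁ , + v₂ , + v₃ , + v₄ , tt) , + w

    q₁ q₂ q₃ b p₁ p₂ p₃ a : ∣ G₈ ∣ᴳ
    q₁ = element 1 0 0  1 0 1 1  2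
    q₂ = element 0 1 0  1 1 0 1  2
    q₃ = element 0 0 1  1 1 1 0  2
    b  = element 0 0 0  1 0 0 0  1
    p₁ = element 0 0 0  0 1 0 0  2
    p₂ = element 0 0 0  0 0 1 0  2
    p₃ = element 0 0 0  0 0 0 1  2
    a  = element 0 0 0  0 0 0 0  1

    basis : Vec ∣ G₈ ∣ᴳ 8
    basis = q₁ ∷ q₂ ∷ q₃ ∷ b ∷ p₁ ∷ p₂ ∷ p₃ ∷ a ∷ []

    multiplicities : Vec ℕ 8
    multiplicities = Vec.map (λ v → n + v * m) capacities

    zero-sum⇒zeros : ∀ ns → VecPointwise.Pointwise _≤_ ns multiplicities → σ G₈ (blocks basis ns) ≈ ε →
                     ns ≡ Vec.replicate 8 0
    zero-sum⇒zeros ns@(κ₁ ∷ κ₂ ∷ κ₃ ∷ β ∷ π₁ ∷ π₂ ∷ π₃ ∷ α ∷ []) bound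
      ((u₁ , u₂ , u₃ , _) , (v₁ , v₂ , v₃ , v₄ , _) , w) =
      conclude (divide-box n (m∣κ₁ ∷ m∣κ₂ ∷ m∣κ₃ ∷ m∣β ∷ m∣π₁ ∷ m∣π₂ ∷ m∣π₃ ∷ m∣α ∷ []) bound)
      where
      coordinate : ∀ π cs {d} → π ε ≡ + 0 → (∀ x y → π (x ∙ y) ≡ π x ℤ.+ π y) → Vec.map π basis ≡ Vec.map +_ cs →
                   π (σ G₈ (blocks basis ns)) ≡ + 0 [mod d ] → d ∣ dot cs ns
      coordinate π cs π-ε π-∙ = ∣-dot G₈ π π-ε π-∙ basis cs ns

      m∣u₁ : m ∣ dot row-u₁ ns
      m∣u₁ = coordinate (λ ((x , _) , _) → x) row-u₁ refl (λ _ _ → refl) refl u₁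
      m∣u₂ : m ∣ dot row-u₂ ns
      m∣u₂ = coordinate (λ ((_ , x , _) , _) → x) row-u₂ refl (λ _ _ → refl) refl u₂
      m∣u₃ : m ∣ dot row-u₃ ns
      m∣u₃ = coordinate (λ ((_ , _ , x , _) , _) → x) row-u₃ refl (λ _ _ → refl) refl u₃
      2m∣v₁ : 2 * m ∣ dot row-v₁ ns
      2m∣v₁ = coordinate (λ (_ , (x , _) , _) → x) row-v₁ refl (λ _ _ → refl) refl v₁
      2m∣v₂ : 2 * m ∣ dot row-v₂ ns
      2m∣v₂ = coordinate (λ (_ , (_ , x , _) , _) → x) row-v₂ refl (λ _ _ → refl) refl v₂
      2m∣v₃ : 2 * m ∣ dot row-v₃ ns
      2m∣v₃ = coordinate (λ (_ , (_ , _ , x , _) , _) → x) row-v₃ refl (λ _ _ → refl) refl v₃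
      2m∣v₄ : 2 * m ∣ dot row-v₄ ns
      2m∣v₄ = coordinate (λ (_ , (_ , _ , _ , x , _) , _) → x) row-v₄ refl (λ _ _ → refl) refl v₄
      6m∣w : 6 * m ∣ dot row-w ns
      6m∣w = coordinate (λ (_ , _ , x) → x) row-w refl (λ _ _ → refl) refl w

      -- Modulo `m` the rows are solved in turn for their diagonal entries; the moduli `2 * m` and
      -- `6 * m` are weakened to `m` for this.
      m∣κ₁ : m ∣ κ₁
      m∣κ₁ = pivot [] (κ₂ ∷ κ₃ ∷ β ∷ π₁ ∷ π₂ ∷ π₃ ∷ α ∷ []) [] m∣u₁
      m∣κ₂ : m ∣ κ₂
      m∣κ₂ = pivot (0 ∷ []) (κ₃ ∷ β ∷ π₁ ∷ π₂ ∷ π₃ ∷ α ∷ []) (m∣κ₁ ∷ []) m∣u₂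
      m∣κ₃ : m ∣ κ₃
      m∣κ₃ = pivot (0 ∷ 0 ∷ []) (β ∷ π₁ ∷ π₂ ∷ π₃ ∷ α ∷ []) (m∣κ₁ ∷ m∣κ₂ ∷ []) m∣u₃
      m∣β : m ∣ β
      m∣β = pivot (1 ∷ 1 ∷ 1 ∷ []) (π₁ ∷ π₂ ∷ π₃ ∷ α ∷ []) (m∣κ₁ ∷ m∣κ₂ ∷ m∣κ₃ ∷ [])
        (ℕ.m*n∣⇒n∣ 2 m 2m∣v₁)
      m∣π₁ : m ∣ π₁
      m∣π₁ = pivot (0 ∷ 1 ∷ 1 ∷ 0 ∷ []) (π₂ ∷ π₃ ∷ α ∷ []) (m∣κ₁ ∷ m∣κ₂ ∷ m∣κ₃ ∷ m∣β ∷ [])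
        (ℕ.m*n∣⇒n∣ 2 m 2m∣v₂)
      m∣π₂ : m ∣ π₂
      m∣π₂ = pivot (1 ∷ 0 ∷ 1 ∷ 0 ∷ 0 ∷ []) (π₃ ∷ α ∷ []) (m∣κ₁ ∷ m∣κ₂ ∷ m∣κ₃ ∷ m∣β ∷ m∣π₁ ∷ [])
        (ℕ.m*n∣⇒n∣ 2 m 2m∣v₃)
      m∣π₃ : m ∣ π₃
      m∣π₃ = pivot (1 ∷ 1 ∷ 0 ∷ 0 ∷ 0 ∷ 0 ∷ []) (α ∷ []) (m∣κ₁ ∷ m∣κ₂ ∷ m∣κ₃ ∷ m∣β ∷ m∣π₁ ∷ m∣π₂ ∷ [])
        (ℕ.m*n∣⇒n∣ 2 m 2m∣v₄)
      m∣α : m ∣ α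
      m∣α = pivot (2 ∷ 2 ∷ 2 ∷ 1 ∷ 2 ∷ 2 ∷ 2 ∷ []) []
        (m∣κ₁ ∷ m∣κ₂ ∷ m∣κ₃ ∷ m∣β ∷ m∣π₁ ∷ m∣π₂ ∷ m∣π₃ ∷ []) (ℕ.m*n∣⇒n∣ 6 m 6m∣w)

      conclude : ∃[ ks ] (ns ≡ Vec.map (_* m) ks × VecPointwise.Pointwise _≤_ ks capacities) →
                 ns ≡ Vec.replicate 8 0
      conclude (ks , eq , bound′) = ≡.trans eq (cong (Vec.map (_* m)) (box-zeroSumFree ks bound′
        (cancel row-v₁ 2m∣v₁) (cancel row-v₂ 2m∣v₂) (cancel row-v₃ 2m∣v₃) (cancel row-v₄ 2m∣v₄) (cancel row-w 6m∣w)))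
        where
        -- The full moduli are used here: removing the factor `m` from `2 * m` and `6 * m` leaves 2
        -- and 6, the moduli of the case m = 1.
        cancel : ∀ cs {c} → c * m ∣ dot cs ns → c ∣ dot cs ks
        cancel cs {c} cm∣ = ℕ.*-cancelʳ-∣ m (subst (c * m ∣_) (≡.trans (cong (dot cs) eq) (dot-* m cs ks)) cm∣)

    U V W : AbGroup
    U = C m ^⊕ 3
    V = C (2 * m) ^⊕ 4
    W = C (6 * m)

    ⟨basis⟩ : ∣ G₈ ∣ᴳ → Set
    ⟨basis⟩ = ⟨_⟩ G₈ (Vec.toList basis)

    G₈-generates : Generates G₈ (Vec.toList basis)
    G₈-generates = covers-⊕ U (V ⊕ W) id-hom
      (covers-C^⊕ m 3 (inˡ-hom U (V ⊕ W)) u∈)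
      (covers-⊕ V W (inʳ-hom U (V ⊕ W))
        (covers-C^⊕ (2 * m) 4 (hom-∘ V (V ⊕ W) G₈ (inʳ-hom U (V ⊕ W)) (inˡ-hom V W)) v∈)
        (covers-C (6 * m) (hom-∘ W (V ⊕ W) G₈ (inʳ-hom U (V ⊕ W)) (inʳ-hom V W)) a∈))
      where
      id-hom : IsHom G₈ G₈ id
      id-hom = Identity.isGroupHomomorphism (AbelianGroup.rawGroup G₈) (AbelianGroup.refl G₈)

      infixl 6 _-_
      _-_ : ∀ {x y} → ⟨basis⟩ x → ⟨basis⟩ y → ⟨basis⟩ (x ∙ y ⁻¹)
      x∈ - y∈ = mul x∈ (inv y∈)

      q₁∈ : ⟨basis⟩ q₁
      q₁∈ = gen (here refl)
      q₂∈ : ⟨basis⟩ q₂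
      q₂∈ = gen (there (here refl))
      q₃∈ : ⟨basis⟩ q₃
      q₃∈ = gen (there (there (here refl)))
      b∈ : ⟨basis⟩ b
      b∈ = gen (there (there (there (here refl))))
      p₁∈ : ⟨basis⟩ p₁
      p₁∈ = gen (there (there (there (there (here refl)))))
      p₂∈ : ⟨basis⟩ p₂
      p₂∈ = gen (there (there (there (there (there (here refl))))))
      p₃∈ : ⟨basis⟩ p₃
      p₃∈ = gen (there (there (there (there (there (there (here refl)))))))
      a∈ : ⟨basis⟩ a
      a∈ = gen (there (there (there (there (there (there (there (here refl))))))))

      -- The term `a` is the unit vector of the last summand. Subtracting it isolates the unit
      -- vectors of the v-coordinates, and these together with `a` clear the qᵢ. Each difference
      -- computes to the required vector already over ℤ.
      v∈ : ∀ i → ⟨basis⟩ (inʳ U (V ⊕ W) (inˡ V W (unitVector (2 * m) 4 i)))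
      v∈ zero = b∈ - a∈
      v∈ (suc zero) = p₁∈ - a∈ - a∈
      v∈ (suc (suc zero)) = p₂∈ - a∈ - a∈
      v∈ (suc (suc (suc zero))) = p₃∈ - a∈ - a∈

      u∈ : ∀ i → ⟨basis⟩ (inˡ U (V ⊕ W) (unitVector m 3 i))
      u∈ zero = q₁∈ - v∈ zero - v∈ (suc (suc zero)) - v∈ (suc (suc (suc zero))) - a∈ - a∈
      u∈ (suc zero) = q₂∈ - v∈ zero - v∈ (suc zero) - v∈ (suc (suc (suc zero))) - a∈ - a∈
      u∈ (suc (suc zero)) = q₃∈ - v∈ zero - v∈ (suc zero) - v∈ (suc (suc zero)) - a∈ - a∈

  FreeGenerating-G₈ : FreeGenerating G₈ (Vec.sum multiplicities) 8
  FreeGenerating-G₈ = record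
    { S = blocks basis multiplicities
    ; B = Vec.toList basis
    ; length-S = length-blocks basis multiplicities
    ; length-B = refl
    ; zeroSumFree = free
    ; B⊆S = ∈-blocks (positive 1 ∷ positive 1 ∷ positive 1 ∷ positive 1 ∷
                      positive 1 ∷ positive 1 ∷ positive 1 ∷ positive 3 ∷ [])
    ; generates = G₈-generates
    }
    where
    positive : ∀ c → 1 ≤ n + c * m
    positive c = ℕ.≤-trans (>-nonZero⁻¹ n) (ℕ.m≤m+n n (c * m))
    free : ZeroSumFree G₈ (blocks basis multiplicities)
    free T T⊆ T≢[] σ≈ε with ns , bound , refl ← ⊆-blocks⁻ basis multiplicities T⊆
      with refl ← zero-sum⇒zeros ns bound σ≈ε = T≢[] refl

-- Invariant factors

-- Pure reassociation: the `𝟘` that closes `C n ^⊕ k` is dropped and the nested pairs are flattened.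
^⊕-≅-⨁C : ∀ {H ns} n k → H ≅ ⨁C ns → C n ^⊕ k ⊕ H ≅ ⨁C (replicate k n ++ ns)
^⊕-≅-⨁C {H} {ns} n zero (f , iso) = ≅-intro (𝟘 ⊕ H) (⨁C ns) (f ∘ proj₂)
  (isHom (𝟘 ⊕ H) (⨁C ns) (f ∘ proj₂) (⟦⟧-cong ∘ proj₂) (λ _ _ → homo _ _))
  (λ eq → tt , injective eq)
  (λ y → (tt , proj₁ (surjective y)) , proj₂ (surjective y) (AbelianGroup.refl H))
  where open IsGroupIsomorphism iso renaming (∙-homo to homo)
^⊕-≅-⨁C {H} {ns} n (suc k) H≅ with f , iso ← ^⊕-≅-⨁C {H} {ns} n k H≅ =
  ≅-intro G K g
    (isHom G K g (λ ((p , q) , r) → p , ⟦⟧-cong (q , r)) (λ _ _ → mod-reflexive refl , homo _ _))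
    (λ (p , q) → let (r , s) = injective q in (p , r) , s)
    (λ (x , y) → let ((z , w) , eq) = surjective y in
       ((x , z) , w) , mod-reflexive refl , eq (AbelianGroup.refl (C n ^⊕ k ⊕ H)))
  where
  open IsGroupIsomorphism iso renaming (∙-homo to homo)
  G = C n ^⊕ suc k ⊕ H
  K = ⨁C (n ∷ replicate k n ++ ns)
  g : ∣ G ∣ᴳ → ∣ K ∣ᴳ
  g ((x , y) , z) = x , f (y , z)

C-≅-⨁C : ∀ n → C n ≅ ⨁C (n ∷ [])
C-≅-⨁C n = ≅-intro (C n) (⨁C (n ∷ [])) (_, tt)
  (isHom (C n) (⨁C (n ∷ [])) (_, tt) (_, tt) (λ _ _ → mod-reflexive refl , tt))
  proj₁ (λ (x , _) → x , mod-reflexive refl , tt)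

linked-replicate-++ : ∀ {n k ns} j → n ∣ k → Linked _∣_ (k ∷ ns) → Linked _∣_ (replicate j n ++ k ∷ ns)
linked-replicate-++ zero n∣k l = l
linked-replicate-++ (suc zero) n∣k l = n∣k ∷ l
linked-replicate-++ (suc (suc j)) n∣k l = ∣-refl ∷ linked-replicate-++ (suc j) n∣k l

sum-replicate-++ : ∀ j n ns → sum (map (_∸ 1) (replicate j n ++ ns)) ≡ j * (n ∸ 1) + sum (map (_∸ 1) ns)
sum-replicate-++ zero n ns = refl
sum-replicate-++ (suc j) n ns = ≡.trans (cong (λ l → n ∸ 1 + l) (sum-replicate-++ j n ns))
  (≡.sym (ℕ.+-assoc (n ∸ 1) (j * (n ∸ 1)) _))

-- Arbitrary rank `8 + k`

-- Groups are spelled exactly as G[_,_] unfolds: comparing other spellings, although they are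
-- definitionally equal, is prohibitively slow.
module _ (n : ℕ) .{{_ : NonZero n}} (k : ℕ) where
  private
    m r : ℕ
    m = suc n
    r = 8 + k

    invariants : List ℕ
    invariants = replicate (3 + k) m ++ replicate 4 (2 * m) ++ 6 * m ∷ []

  G[,]-≅-⨁C : G[ suc n , 8 + k ] ≅ ⨁C invariants
  G[,]-≅-⨁C = ^⊕-≅-⨁C {C (2 * suc n) ^⊕ 4 ⊕ C (6 * suc n)} {replicate 4 (2 * m) ++ 6 * m ∷ []}
    (suc n) (8 + k ∸ 5)
    (^⊕-≅-⨁C {C (6 * suc n)} {6 * m ∷ []} (2 * suc n) 4 (C-≅-⨁C (6 * suc n)))

  -- The `k` extra coordinates move behind the three copies of `C m` in `G₈`, since `8 + k ∸ 5`
  -- computes to `3 + k`.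
  C^⊕-⊕-G₈-≅ : C (suc n) ^⊕ k ⊕ G₈ n ≅ G[ suc n , 8 + k ]
  C^⊕-⊕-G₈-≅ = ≅-intro K G[ suc n , 8 + k ] f
    (isHom K G[ suc n , 8 + k ] f (λ (p , (q₁ , q₂ , q₃ , _) , q) → (q₁ , q₂ , q₃ , p) , q)
      (λ _ _ → AbelianGroup.refl G[ suc n , 8 + k ]))
    (λ ((q₁ , q₂ , q₃ , p) , q) → p , (q₁ , q₂ , q₃ , tt) , q)
    (λ ((x , y , z , t) , w) → (t , (x , y , z , tt) , w) , AbelianGroup.refl G[ suc n , 8 + k ])
    where
    K = C (suc n) ^⊕ k ⊕ G₈ n
    f : ∣ K ∣ᴳ → ∣ G[ suc n , 8 + k ] ∣ᴳ
    f (t , (x , y , z , _) , w) = (x , y , z , t) , w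

  FreeGenerating-G[,] : FreeGenerating G[ suc n , 8 + k ] ((r + 10) * m ∸ r) r
  FreeGenerating-G[,] = subst₂ (FreeGenerating G[ suc n , 8 + k ]) (≡.sym length-eq) (ℕ.+-comm k 8)
    (FreeGenerating-≅ {C (suc n) ^⊕ k ⊕ G₈ n} {G[ suc n , 8 + k ]} C^⊕-⊕-G₈-≅
      (FreeGenerating-⊕ {C (suc n) ^⊕ k} {G₈ n} (FreeGenerating-C^⊕ n k) (FreeGenerating-G₈ n)))
    where
    -- These are 2m - 1, 4m - 1 and the total length, written as `Vec.sum multiplicities` unfolds.
    -- The identity below adds `r` on the right so that the ring solver meets no truncated
    -- subtraction.
    c₁ c₃ ℓ : ℕ
    c₁ = n + 1 * m
    c₃ = n + 3 * m
    ℓ = k * n + (c₁ + (c₁ + (c₁ + (c₁ + (c₁ + (c₁ + (c₁ + (c₃ + 0))))))))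
    identity : ∀ n k → let c₁ = n + 1 * (1 + n) ; c₃ = n + 3 * (1 + n) in
      (8 + k + 10) * (1 + n) ≡ k * n + (c₁ + (c₁ + (c₁ + (c₁ + (c₁ + (c₁ + (c₁ + (c₃ + 0)))))))) + (8 + k)
    identity = ℕ-Solver.solve-∀
    length-eq : (r + 10) * m ∸ r ≡ ℓ
    length-eq = ≡.trans (cong (_∸ r) (identity n k)) (ℕ.m+n∸n≡m ℓ r)

  length-invariants : length invariants ≡ r
  length-invariants = ≡.trans (List.length-++ (replicate (3 + k) m))
    (≡.trans (cong (_+ 5) (List.length-replicate (3 + k))) (ℕ.+-comm (3 + k) 5))

  rank : IsRank G[ suc n , 8 + k ] r
  rank = (B F , length-B F , generates F) ,
    λ S gens → subst (_≤ length S) length-invariants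
      (rank-≥ m {G = G[ suc n , 8 + k ]} {invariants} 2≤m (All.++⁺ (All.replicate⁺ (3 + k) ∣-refl)
        (All.++⁺ (All.replicate⁺ 4 (ℕ.n∣m*n 2)) (ℕ.n∣m*n 6 ∷ []))) G[,]-≅-⨁C S gens)
    where
    F = FreeGenerating-G[,]
    2≤m : 2 ≤ m
    2≤m = s≤s (>-nonZero⁻¹ n)

  dStar : IsDStar G[ suc n , 8 + k ] ((r + 9) * m ∸ r)
  dStar = invariants
    , All.++⁺ (All.replicate⁺ (3 + k) 1<m)
        (All.++⁺ (All.replicate⁺ 4 (ℕ.<-≤-trans 1<m (ℕ.m≤n*m m 2))) (ℕ.<-≤-trans 1<m (ℕ.m≤n*m m 6) ∷ []))
    , linked-replicate-++ (3 + k) (ℕ.n∣m*n 2) (linked-replicate-++ 4 2m∣6m [-])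
    , G[,]-≅-⨁C
    , sum-eq
    where
    1<m : 1 < m
    1<m = s≤s (>-nonZero⁻¹ n)
    2m∣6m : 2 * m ∣ 6 * m
    2m∣6m = ℕ.*-monoˡ-∣ m 2∣6
      where
      2∣6 : 2 ∣ 6
      2∣6 = divides-refl 3
    -- The invariants m, 2m and 6m contribute `n`, `n + 1 * m` and `n + 5 * m`, each one less than
    -- the invariant.
    ℓ = (3 + k) * n + (4 * (n + 1 * m) + (n + 5 * m + 0))
    identity : ∀ n k → (8 + k + 9) * (1 + n) ≡
      (3 + k) * n + (4 * (n + 1 * (1 + n)) + (n + 5 * (1 + n) + 0)) + (8 + k)
    identity = ℕ-Solver.solve-∀
    sum-eq : sum (map (_∸ 1) invariants) ≡ (r + 9) * m ∸ r
    sum-eq = ≡.trans (sum-replicate-++ (3 + k) m (replicate 4 (2 * m) ++ 6 * m ∷ []))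
      (≡.trans (cong (λ l → (3 + k) * n + l) (sum-replicate-++ 4 (2 * m) (6 * m ∷ [])))
      (≡.sym (≡.trans (cong (_∸ r) (identity n k)) (ℕ.m+n∸n≡m ℓ r))))

  enumeration : Enumeration G[ suc n , 8 + k ] (m ^ (3 + k) * ((2 * m) ^ 4 * (6 * m)))
  enumeration = Enumeration-⊕ {C (suc n) ^⊕ (8 + k ∸ 5)} {C (2 * suc n) ^⊕ 4 ⊕ C (6 * suc n)}
    (Enumeration-^⊕ (3 + k) (Enumeration-C (suc n)))
    (Enumeration-⊕ {C (2 * suc n) ^⊕ 4} {C (6 * suc n)}
      (Enumeration-^⊕ 4 (Enumeration-C (2 * suc n))) (Enumeration-C (6 * suc n)))

  -- Maximality puts `d` above the length of the constructed sequence, which exceeds the value of 𝖽*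
  -- by exactly `m`.
  gap : ∃[ d ] (IsSmallDavenport G[ suc n , 8 + k ] d) →
        ∃[ d ] ∃[ d* ] (IsSmallDavenport G[ suc n , 8 + k ] d × IsDStar G[ suc n , 8 + k ] d* × d ∸ d* ≥ m)
  gap (d , max , bound) =
    d , (r + 9) * m ∸ r , (max , bound) , dStar ,
    subst (_≤ d ∸ ((r + 9) * m ∸ r)) difference
      (ℕ.∸-monoˡ-≤ ((r + 9) * m ∸ r) (subst (_≤ d) (length-S F) (bound (S F) (zeroSumFree F))))
    where
    F = FreeGenerating-G[,]
    -- Ensures that subtracting `r` from `(r + 9) * m` does not truncate.
    r≤ : r ≤ (r + 9) * m
    r≤ = ℕ.≤-trans (ℕ.m≤m+n r 9) (ℕ.m≤m*n (r + 9) m)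
    identity : ∀ r m → (r + 10) * m ≡ m + (r + 9) * m
    identity = ℕ-Solver.solve-∀
    difference : ((r + 10) * m ∸ r) ∸ ((r + 9) * m ∸ r) ≡ m
    difference = ≡.trans (cong (λ l → l ∸ r ∸ ((r + 9) * m ∸ r)) (identity r m))
      (≡.trans (cong (_∸ ((r + 9) * m ∸ r)) (ℕ.+-∸-assoc m r≤)) (ℕ.m+n∸n≡m m ((r + 9) * m ∸ r)))

  generating-zeroSumFree :
    ∃[ S ] (length S ≡ (r + 10) * m ∸ r × ZeroSumFree G[ suc n , 8 + k ] S × Generates G[ suc n , 8 + k ] S)
  generating-zeroSumFree = S F , length-S F , zeroSumFree F ,
    λ x → ⟨⟩-mono G[ suc n , 8 + k ] (B⊆S F) (generates F x)
    where F = FreeGenerating-G[,]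

theorem3p1 : ∀ (r m : ℕ) → r ≥ 8 → m ≥ 2 →
    IsRank G[ m , r ] r
    × (∃[ S ] (length S ≡ (r + 10) * m ∸ r × ZeroSumFree G[ m , r ] S × Generates G[ m , r ] S))
    × IsDStar G[ m , r ] ((r + 9) * m ∸ r)
    × (∃[ d ] ∃[ d* ] (IsSmallDavenport G[ m , r ] d × IsDStar G[ m , r ] d* × d ∸ d* ≥ m))
theorem3p1 r (suc n@(suc _)) r≥8 (s≤s (s≤s _)) = subst
  (λ r → IsRank G[ suc n , r ] r
    × (∃[ S ] (length S ≡ (r + 10) * suc n ∸ r × ZeroSumFree G[ suc n , r ] S × Generates G[ suc n , r ] S))
    × IsDStar G[ suc n , r ] ((r + 9) * suc n ∸ r)
    × (∃[ d ] ∃[ d* ] (IsSmallDavenport G[ suc n , r ] d × IsDStar G[ suc n , r ] d* × d ∸ d* ≥ suc n)))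
  -- The results hold for ranks of the form `8 + k`; they are transported along `8 + (r ∸ 8) ≡ r`.
  (ℕ.m+[n∸m]≡n r≥8)
  (rank n k , generating-zeroSumFree n k , dStar n k , gap n k (smallDavenport (enumeration n k)))
  where k = r ∸ 8
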